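{- There is an algorithm that decides in $O(k n^3)$ time whether a one-row (or equivalently one-column) $k$-color Clickomania puzzle with $n$ groups is solvable.
   Context: A one-row (equivalently, one-column) $k$-color Clickomania puzzle is a finite word $w$ over the alphabet $\{c_1,\dots,c_k\}$; its letters are called blocks. A group is a maximal run of consecutive equal letters. A move (click) deletes a group of length at least two from the current word; the remaining parts are then concatenated (so that the two neighbors of the deleted group, if they have the same color, merge into one group). A puzzle is solvable if some sequence of moves deletes all blocks. The parameter $n$ denotes the number of groups of the initial puzzle. Replacing every group with more than two blocks by a group of exactly two blocks does not affect solvability and takes time linear in the number of blocks; the time bound refers to puzzles to which this reduction has been applied (so the word has length at most $2n$), with the usual unit-cost RAM model. -}

module Defs where

open import Data.Bool.Base using (Bool; if_then_else_)
open import Data.Fin.Base using (Fin; toℕ)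
open import Data.Fin.Properties using (_≟_)
open import Data.List.Base using (List; []; _++_; head; last; drop; length; replicate; derun)
open import Data.Maybe.Base using (Maybe; just; maybe′)
open import Data.Nat.Base using (ℕ; suc; _+_; _∸_; _≤_; _≡ᵇ_)
open import Data.Sum.Base using (_⊎_; inj₁; inj₂)
open import Relation.Binary.Construct.Closure.ReflexiveTransitive using (Star)
open import Relation.Binary.PropositionalEquality using (_≡_; _≢_)

------------------------------------------------------------------------
-- One-row Clickomania

Puzzle : ℕ → Set
Puzzle k = List (Fin k)

-- For m ≥ 1: the occurrence of cᵐ between u and v in u ++ cᵐ ++ v is a
-- maximal run, i.e. a group.
record MaximalRun {k} (u : Puzzle k) (c : Fin k) (v : Puzzle k) : Set where
  constructor maximalRun
  field
    left  : last u ≢ just c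
    right : head v ≢ just c

infix 4 _⟶_

data _⟶_ {k} : Puzzle k → Puzzle k → Set where
  click : ∀ u c m v → MaximalRun u c v → 2 ≤ m →
          u ++ replicate m c ++ v ⟶ u ++ v

Solvable : ∀ {k} → Puzzle k → Set
Solvable w = Star _⟶_ w []

-- derun keeps one letter from each run of equal letters.
#groups : ∀ {k} → Puzzle k → ℕ
#groups w = length (derun _≟_ w)

Reduced : ∀ {k} → Puzzle k → Set
Reduced w = ∀ u c m v → MaximalRun u c v → w ≡ u ++ replicate m c ++ v → m ≤ 2

------------------------------------------------------------------------
-- Unit-cost random access machines

-- A program mentions only finitely many registers, so the registers form
-- a fixed finite set for each program; only `load` and `store` address
-- the memory, indirectly through a register.
Reg Label : Set
Reg   = ℕ
Label = ℕ

data Instr : Set where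
  const : Reg → ℕ → Instr            -- r ← n
  add   : Reg → Reg → Reg → Instr    -- r ← s + t
  sub   : Reg → Reg → Reg → Instr    -- r ← max (s - t) 0
  load  : Reg → Reg → Instr          -- r ← mem[s]
  store : Reg → Reg → Instr          -- mem[r] ← s
  jump  : Label → Instr
  jzero : Reg → Label → Instr        -- jump if r = 0
  halt  : Bool → Instr               -- stop, answering the given Boolean

Program : Set
Program = List Instr

Store : Set
Store = ℕ → ℕ

_[_≔_] : Store → ℕ → ℕ → Store
(σ [ a ≔ x ]) b = if b ≡ᵇ a then x else σ b

record State : Set where
  constructor ⟨_,_,_⟩
  field
    pc  : Label
    reg : Store
    mem : Store

exec : Instr → State → State ⊎ Bool
exec (const r n) ⟨ pc , ρ , μ ⟩ = inj₁ ⟨ suc pc , ρ [ r ≔ n ] , μ ⟩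
exec (add r s t) ⟨ pc , ρ , μ ⟩ = inj₁ ⟨ suc pc , ρ [ r ≔ ρ s + ρ t ] , μ ⟩
exec (sub r s t) ⟨ pc , ρ , μ ⟩ = inj₁ ⟨ suc pc , ρ [ r ≔ ρ s ∸ ρ t ] , μ ⟩
exec (load r s)  ⟨ pc , ρ , μ ⟩ = inj₁ ⟨ suc pc , ρ [ r ≔ μ (ρ s) ] , μ ⟩
exec (store r s) ⟨ pc , ρ , μ ⟩ = inj₁ ⟨ suc pc , ρ , μ [ ρ r ≔ ρ s ] ⟩
exec (jump l)    ⟨ pc , ρ , μ ⟩ = inj₁ ⟨ l , ρ , μ ⟩
exec (jzero r l) ⟨ pc , ρ , μ ⟩ = inj₁ ⟨ (if ρ r ≡ᵇ 0 then l else suc pc) , ρ , μ ⟩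
exec (halt b)    _              = inj₂ b

-- Running off the end of the program is not halting.
fetch : Program → Label → Maybe Instr
fetch P l = head (drop l P)

-- P ⊢ s ⇓[ t ] b: started in s, the program P halts with answer b after
-- executing exactly t instructions.
infix 4 _⊢_⇓[_]_

data _⊢_⇓[_]_ (P : Program) (s : State) : ℕ → Bool → Set where
  stop : ∀ {i b} → fetch P (State.pc s) ≡ just i → exec i s ≡ inj₂ b →
         P ⊢ s ⇓[ 1 ] b
  step : ∀ {i s′ t b} → fetch P (State.pc s) ≡ just i → exec i s ≡ inj₁ s′ →
         P ⊢ s′ ⇓[ t ] b → P ⊢ s ⇓[ suc t ] b

-- Register 0 holds the number of colors, register 1 the number of blocks,
-- and memory cell i the color of the i-th block; everything else is 0.
initial : ∀ {k} → Puzzle k → State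
initial {k} w = ⟨ 0 , registers , memory ⟩
  where
  registers : Store
  registers 0 = k
  registers 1 = length w
  registers _ = 0

  memory : Store
  memory i = maybe′ toℕ 0 (head (drop i w))

{-# OPTIONS --safe #-}

-- A nonempty word is solvable iff it has the form c u c v with u solvable and
-- with v or c v solvable: the first block disappears in a group whose second
-- block is the displayed c. That only whole groups can be clicked is no obstruction,
-- since lengthening a group preserves solvability. For the factor between
-- the suffixes of lengths r + 1 and s this gives a recurrence over a single
-- intermediate suffix, that of length q + 1, which is tabulated in time
-- O(n³) whatever the number of colors.
module Submission where

open import Defs
open import Data.Bool.Base using (true; false; if_then_else_)
open import Data.Empty using (⊥)
open import Data.Fin.Base using (Fin; toℕ)
open import Data.Fin.Properties using (_≟_; toℕ-injective)
open import Data.List.Base using (List; []; _∷_; _∷ʳ_; _++_; last; head; length; replicate; drop; initLast; _∷ʳ′_)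
open import Data.List.Properties using (++-assoc; ++-identityʳ; ∷-injective; length-++; length-++-≤ʳ; drop-all)
open import Data.List.Relation.Unary.All using (All; []; _∷_)
open import Data.Maybe.Base using (Maybe; just; nothing; maybe′)
open import Data.Maybe.Properties using (just-injective)
open import Data.Nat.Base using (ℕ; zero; suc; _+_; _*_; _^_; _∸_; _≤_; _<_; _≡ᵇ_; z≤n; s≤s)
open import Data.Nat.Properties
  using (≤-refl; ≤-reflexive; ≤-trans; ≤-antisym; ≤-pred; <-irrefl; <⇒≤; ≤∧≢⇒<; m≤n⇒m≤1+n; m<n⇒m<1+n;
         m≤n⇒m<n∨m≡n; ≡⇒≡ᵇ; ≡ᵇ⇒≡; +-comm; +-assoc; +-identityʳ; +-suc; +-cancelˡ-≡;
         +-monoˡ-≤; +-monoʳ-≤; +-mono-≤; m≤m+n; m≤n+m; m+n≡0⇒m≡0; m+n≡0⇒n≡0; +-commutativeSemigroup;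
         *-suc; *-monoˡ-≤; *-monoʳ-≤; m≤n*m; ^-monoˡ-≤; m+n∸n≡m; m∸n≡0⇒m≤n; n∸n≡0; module ≤-Reasoning)
  renaming (_≟_ to _≟ℕ_)
open import Algebra.Properties.CommutativeSemigroup +-commutativeSemigroup using (x∙yz≈y∙xz)
open import Data.Nat.Tactic.RingSolver using (solve-∀)
open import Data.Product.Base using (∃-syntax; _×_; _,_; proj₂)
open import Data.Sum.Base using (_⊎_; inj₁; inj₂; [_,_]; map₂)
open import Function.Base using (_∘_; id)
open import Function.Bundles using (_⇔_; mk⇔; module Equivalence)
open import Relation.Binary.Construct.Closure.ReflexiveTransitive using (ε; _◅_)
open import Relation.Binary.PropositionalEquality using (_≡_; _≢_; refl; sym; trans; cong; cong₂; subst)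
open import Relation.Nullary using (¬_; yes; no; contradiction)
open import Relation.Nullary.Reflects using (Reflects; ofʸ; ofⁿ)
open Equivalence using (to; from)

private
  variable
    k : ℕ

-- Splitting lists and runs

++-split : ∀ {A : Set} (p : List A) {q} u {c v} → p ++ q ≡ u ++ c ∷ v →
           (∃[ r ] u ≡ p ++ r × q ≡ r ++ c ∷ v) ⊎ (∃[ r ] p ≡ u ++ c ∷ r × v ≡ r ++ q)
++-split []      u       refl = inj₁ (u , refl , refl)
++-split (_ ∷ p) []      refl = inj₂ (p , refl , refl)
++-split (_ ∷ p) (_ ∷ u) eq with ∷-injective eq
... | refl , eq′ with ++-split p u eq′
...   | inj₁ (r , refl , e) = inj₁ (r , refl , e)
...   | inj₂ (r , refl , e) = inj₂ (r , refl , e)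

last-++-∷ : ∀ {A : Set} (u : List A) c v → last (u ++ c ∷ v) ≡ last (c ∷ v)
last-++-∷ []          c v = refl
last-++-∷ (_ ∷ [])    c v = refl
last-++-∷ (_ ∷ d ∷ u) c v = last-++-∷ (d ∷ u) c v

replicate-double : ∀ {A : Set} m {d : A} r {c s} → replicate m d ≡ r ++ c ∷ s →
                   r ++ c ∷ c ∷ s ≡ replicate (suc m) d
replicate-double (suc m) []      refl = refl
replicate-double (suc m) (_ ∷ r) eq with ∷-injective eq
... | refl , eq′ = cong (_ ∷_) (replicate-double m r eq′)

-- A grammar for the solvable words

-- The first block c vanishes together with a later block of its color; after
-- u is cleared, either these two suffice and v is cleared separately (pair),
-- or the first block joins a group in the clearing of c ∷ v (merge).
data Clearable {k} : Puzzle k → Set where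
  empty : Clearable []
  pair  : ∀ {c u v} → Clearable u → Clearable v → Clearable (c ∷ u ++ c ∷ v)
  merge : ∀ {c u v} → Clearable u → Clearable (c ∷ v) → Clearable (c ∷ u ++ c ∷ v)

clearable-run : ∀ {c : Fin k} {m v} → 2 ≤ m → Clearable v → Clearable (replicate m c ++ v)
clearable-run {m = 2}               _ g = pair empty g
clearable-run {m = suc (suc (suc m))} _ g = merge empty (clearable-run (s≤s (s≤s z≤n)) g)
clearable-run {m = 1} (s≤s ()) g

-- This reverses a click. The run lands in front, where `clearable-run` applies, or inside `u`, or
-- behind the second displayed `c`. In the last two cases it enlarges just one of the two factors,
-- and the same constructor rebuilds the word.
insert-run : ∀ {c : Fin k} {m x} → 2 ≤ m → Clearable x → ∀ p {q} → x ≡ p ++ q →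
             Clearable (p ++ replicate m c ++ q)
insert-run 2≤m g [] refl = clearable-run 2≤m g
insert-run {c = d} {m} 2≤m (pair {c} {u} {v} gu gv) (_ ∷ p) eq with ∷-injective eq
... | refl , eq′ with ++-split p u (sym eq′)
...   | inj₁ (r , refl , refl) =
  subst (λ z → Clearable (c ∷ z)) (trans (++-assoc p _ _) (cong (p ++_) (++-assoc (replicate m d) r _)))
    (pair (insert-run 2≤m gu p refl) gv)
...   | inj₂ (r , refl , refl) =
  subst (λ z → Clearable (c ∷ z)) (sym (++-assoc u _ _)) (pair gu (insert-run 2≤m gv r refl))
insert-run {c = d} {m} 2≤m (merge {c} {u} {v} gu gv) (_ ∷ p) eq with ∷-injective eq
... | refl , eq′ with ++-split p u (sym eq′)
...   | inj₁ (r , refl , refl) =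
  subst (λ z → Clearable (c ∷ z)) (trans (++-assoc p _ _) (cong (p ++_) (++-assoc (replicate m d) r _)))
    (merge (insert-run 2≤m gu p refl) gv)
...   | inj₂ (r , refl , refl) =
  subst (λ z → Clearable (c ∷ z)) (sym (++-assoc u _ _)) (merge gu (insert-run 2≤m gv (c ∷ r) refl))

solvable⇒clearable : ∀ {w : Puzzle k} → Solvable w → Clearable w
solvable⇒clearable ε = empty
solvable⇒clearable (click u c m v _ 2≤m ◅ moves) =
  insert-run 2≤m (solvable⇒clearable moves) u refl

-- The same clicks are replayed. As long as the doubled letter lies in `p` or `q`, doubling it
-- changes neither `last p` nor `head q`, so the click stays legal; the click that removes it takes
-- one block more.
double-block : ∀ {x} (u : Puzzle k) {c v} → Solvable x → x ≡ u ++ c ∷ v → Solvable (u ++ c ∷ c ∷ v)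
double-block []      ε ()
double-block (_ ∷ _) ε ()
double-block u {c} {v} (click p d m q (maximalRun l r) 2≤m ◅ moves) eq with ++-split p u eq
... | inj₂ (s , refl , refl) =
  subst Solvable (++-assoc u _ _)
    (click (u ++ c ∷ c ∷ s) d m q
       (maximalRun (l ∘ trans (trans (last-++-∷ u c s) (sym (last-++-∷ u c (c ∷ s)))) ) r) 2≤m
     ◅ subst Solvable (sym (++-assoc u _ _)) (double-block u moves (++-assoc u _ _)))
... | inj₁ (s , refl , eq′) with ++-split (replicate m d) s eq′
...   | inj₁ (t , refl , refl) =
  subst Solvable (trans (cong (p ++_) (sym (++-assoc (replicate m d) t _))) (sym (++-assoc p _ _)))
    (click p d m (t ++ c ∷ c ∷ v) (maximalRun l (r ∘ trans (head-double t))) 2≤m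
     ◅ subst Solvable (++-assoc p t _) (double-block (p ++ t) moves (sym (++-assoc p t _))))
  where
  head-double : ∀ t → head (t ++ c ∷ v) ≡ head (t ++ c ∷ c ∷ v)
  head-double []      = refl
  head-double (_ ∷ _) = refl
...   | inj₂ (t , e , refl) =
  subst Solvable
    (trans (cong (λ z → p ++ z ++ q) (sym (replicate-double m s e)))
      (trans (cong (p ++_) (++-assoc s _ q)) (sym (++-assoc p s _))))
    (click p d (suc m) q (maximalRun l r) (m≤n⇒m≤1+n 2≤m) ◅ moves)

extend-run : ∀ (u : Puzzle k) {c} m {v} → Solvable (u ++ c ∷ v) → Solvable (u ++ c ∷ replicate m c ++ v)
extend-run u zero    sol = sol
extend-run u (suc m) sol = double-block u (extend-run u m sol) refl

replicate-∷ : ∀ {A : Set} m {c : A} {v} → replicate m c ++ c ∷ v ≡ c ∷ replicate m c ++ v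
replicate-∷ zero    = refl
replicate-∷ (suc m) = cong (_ ∷_) (replicate-∷ m)

-- If the run is not a group of the new word, it only enlarges a group of
-- u ++ v, which can be cleared all the same.
unclick : ∀ (u : Puzzle k) c {m} v → 2 ≤ m → Solvable (u ++ v) → Solvable (u ++ replicate m c ++ v)
unclick u c {m} v 2≤m sol with initLast u
unclick _ c {m} [] 2≤m sol | [] = click [] c m [] (maximalRun (λ ()) (λ ())) 2≤m ◅ sol
unclick _ c {m} (d ∷ v) 2≤m sol | [] with d ≟ c
... | yes refl = subst Solvable (sym (replicate-∷ m)) (extend-run [] m sol)
... | no d≢c   = click [] c m (d ∷ v) (maximalRun (λ ()) (d≢c ∘ just-injective)) 2≤m ◅ sol
unclick _ c {m} v 2≤m sol | u ∷ʳ′ e with e ≟ c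
... | yes refl =
  subst Solvable (sym (++-assoc u _ _)) (extend-run u m (subst Solvable (++-assoc u _ _) sol))
unclick _ c {m} [] 2≤m sol | u ∷ʳ′ e | no e≢c =
  click (u ∷ʳ e) c m [] (maximalRun (e≢c ∘ just-injective ∘ trans (sym (last-++-∷ u e []))) (λ ())) 2≤m ◅ sol
unclick _ c {m} (d ∷ v) 2≤m sol | u ∷ʳ′ e | no e≢c with d ≟ c
... | yes refl = subst Solvable (cong ((u ∷ʳ e) ++_) (sym (replicate-∷ m))) (extend-run (u ∷ʳ e) m sol)
... | no d≢c   =
  click (u ∷ʳ e) c m (d ∷ v)
    (maximalRun (e≢c ∘ just-injective ∘ trans (sym (last-++-∷ u e []))) (d≢c ∘ just-injective)) 2≤m ◅ sol

-- A group of `x` may merge with neighbors in `u` or `v`, so the clicks of `x` cannot simply be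
-- replayed in context. Its runs are instead put back by `unclick`, the last clicked first.
fill : ∀ {x} (u : Puzzle k) {v} → Solvable x → Solvable (u ++ v) → Solvable (u ++ x ++ v)
fill u ε sol = sol
fill u {v} (click p c m q _ 2≤m ◅ moves) sol =
  subst Solvable
    (trans (++-assoc u p _) (cong (u ++_)
      (trans (cong (p ++_) (sym (++-assoc (replicate m c) q v))) (sym (++-assoc p _ v)))))
    (unclick (u ++ p) c (q ++ v) 2≤m
      (subst Solvable (trans (cong (u ++_) (++-assoc p q v)) (sym (++-assoc u p _)))
        (fill u moves sol)))

clearable⇒solvable : ∀ {w : Puzzle k} → Clearable w → Solvable w
clearable⇒solvable empty = ε
clearable⇒solvable (pair {c} {v = v} gu gv) =
  fill (c ∷ []) (clearable⇒solvable gu) (unclick [] c v (s≤s (s≤s z≤n)) (clearable⇒solvable gv))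
clearable⇒solvable (merge {c} gu gv) =
  fill (c ∷ []) (clearable⇒solvable gu) (double-block [] (clearable⇒solvable gv) refl)

-- Length of a reduced word against its number of groups

strip-run : ∀ (c : Fin k) w → ∃[ n ] ∃[ v ] w ≡ replicate n c ++ v × head v ≢ just c
strip-run c []      = 0 , [] , refl , λ ()
strip-run c (d ∷ w) with d ≟ c
... | no d≢c = 0 , d ∷ w , refl , d≢c ∘ just-injective
... | yes refl with strip-run c w
...   | n , v , eq , hd = suc n , v , cong (c ∷_) eq , hd

reduced-tail : ∀ {c} {w : Puzzle k} → Reduced (c ∷ w) → Reduced w
reduced-tail {c = c} red []      d m v (maximalRun _ r) eq with c ≟ d
-- A leading run of color `c` is one block longer in `c ∷ w`.
... | yes refl = ≤-trans (m≤n⇒m≤1+n ≤-refl) (red [] c (suc m) v (maximalRun (λ ()) r) (cong (c ∷_) eq))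
... | no c≢d   = red (c ∷ []) d m v (maximalRun (c≢d ∘ just-injective) r) (cong (c ∷_) eq)
reduced-tail {c = c} red (e ∷ u) d m v (maximalRun l r) eq =
  red (c ∷ e ∷ u) d m v (maximalRun l r) (cong (c ∷_) eq)

reduced⇒no-triple : ∀ {c} {w : Puzzle k} → ¬ Reduced (c ∷ c ∷ c ∷ w)
reduced⇒no-triple {c = c} {w} red with strip-run c w
... | n , v , eq , hd
  with red [] c (3 + n) v (maximalRun (λ ()) hd) (cong (λ z → c ∷ c ∷ c ∷ z) eq)
... | s≤s (s≤s ())

-- The first group is peeled off: one block, or two when the first two blocks agree, the third then
-- differing by `reduced⇒no-triple`.
length≤2*#groups : ∀ (w : Puzzle k) → Reduced w → length w ≤ 2 * #groups w
length≤2*#groups []          red = z≤n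
length≤2*#groups (c ∷ [])    red = s≤s z≤n
length≤2*#groups (c ∷ d ∷ []) red with c ≟ d
... | no _  = s≤s (s≤s z≤n)
... | yes _ = ≤-refl
length≤2*#groups (c ∷ d ∷ e ∷ w) red
  with c ≟ d | d ≟ e | length≤2*#groups (d ∷ e ∷ w) (reduced-tail red)
     | length≤2*#groups (e ∷ w) (reduced-tail (reduced-tail red))
... | no _     | _        | ih | _  = ≤-trans (s≤s (m≤n⇒m≤1+n ih)) (≤-reflexive (sym (*-suc 2 _)))
... | yes refl | yes refl | _  | _  = contradiction red reduced⇒no-triple
... | yes refl | no _     | _  | ih = ≤-trans (s≤s (s≤s ih)) (≤-reflexive (sym (*-suc 2 _)))

-- The recurrence over pairs of suffixes

-- Clears r s says that the word between the suffixes of lengths r and s can be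
-- cleared, and letter r is the first letter of the suffix of length suc r.
module Positions (letter : ℕ → ℕ) where
  mutual
    data Clears : ℕ → ℕ → Set where
      done : ∀ {r} → Clears r r
      via  : ∀ {r q s} → Via r q s → Clears (suc r) s

    -- The partner of the first block starts the suffix of length `suc q`, and the two alternatives
    -- mirror `pair` and `merge`. The condition `s ≤ q` puts the partner inside the factor: without
    -- it, `done` would give `Clears (suc q) s` for `s` equal to `suc q`.
    Via : ℕ → ℕ → ℕ → Set
    Via r q s = letter r ≡ letter q × Clears r (suc q) × s ≤ q × (Clears q s ⊎ Clears (suc q) s)

  clears⇒≥ : ∀ {r s} → Clears r s → s ≤ r
  clears⇒≥ done = ≤-refl
  clears⇒≥ (via (_ , cl , s≤q , _)) = m≤n⇒m≤1+n (≤-trans (m≤n⇒m≤1+n s≤q) (clears⇒≥ cl))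

module _ {k} (w : Puzzle k) where

  -- As `color` is the initial memory itself, the invariant on the input holds at the start by
  -- `refl`.
  color letter : ℕ → ℕ
  color = State.mem (initial w)
  letter r = color (length w ∸ suc r)

  open Positions letter

  color-drop : ∀ p {c y} → maybe′ toℕ 0 (head (drop (length p) (p ++ c ∷ y))) ≡ toℕ {k} c
  color-drop []      = refl
  color-drop (_ ∷ p) = color-drop p

  letter-suffix : ∀ p {c y} → w ≡ p ++ c ∷ y → letter (length y) ≡ toℕ c
  letter-suffix p {c} {y} refl
    rewrite length-++ p {c ∷ y} | m+n∸n≡m (length p) (suc (length y)) = color-drop p

  clears⇒clearable : ∀ {r s} → Clears r s → ∀ p x → w ≡ p ++ x → length x ≡ r →
                     ∃[ u ] ∃[ y ] x ≡ u ++ y × length y ≡ s × Clearable u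
  clears⇒clearable done p x eq len = [] , x , refl , len , empty
  clears⇒clearable (via (e , cl , s≤q , rest)) p (c ∷ x) eq refl
    with clears⇒clearable cl (p ∷ʳ c) x (trans eq (sym (++-assoc p _ _))) refl
  ... | u , d ∷ y , refl , refl , gu
    with toℕ-injective (trans (sym (letter-suffix p eq)) (trans e
           (letter-suffix (p ++ c ∷ u) (trans eq (sym (++-assoc p (c ∷ u) _))))))
  ... | refl with rest
  ...   | inj₁ cl′
    with clears⇒clearable cl′ ((p ++ c ∷ u) ∷ʳ c) y
           (trans eq (trans (sym (++-assoc p (c ∷ u) _)) (sym (++-assoc (p ++ c ∷ u) _ _)))) refl
  ...     | v , z , refl , len , gv =
    c ∷ u ++ c ∷ v , z , cong (c ∷_) (sym (++-assoc u _ z)) , len , pair gu gv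
  clears⇒clearable (via (e , cl , s≤q , rest)) p (c ∷ x) eq refl
      | u , d ∷ y , refl , refl , gu | refl | inj₂ cl′
    with clears⇒clearable cl′ (p ++ c ∷ u) (c ∷ y)
           (trans eq (sym (++-assoc p (c ∷ u) _))) refl
  -- An empty factor here means that `s` is `suc q`, so that the partner would be missing.
  ...     | [] , z , refl , refl , gv = contradiction s≤q (<-irrefl refl)
  ...     | _ ∷ v , z , refl , len , gv =
    c ∷ u ++ c ∷ v , z , cong (c ∷_) (sym (++-assoc u _ z)) , len , merge gu gv

  clearable⇒clears : ∀ {u} → Clearable u → ∀ p y → w ≡ p ++ u ++ y → Clears (length (u ++ y)) (length y)
  clearable⇒clears empty p y eq = done
  clearable⇒clears (pair {c} {u} {v} gu gv) p y eq
    rewrite ++-assoc u (c ∷ v) y = via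
      ( trans (letter-suffix p eq) (sym (letter-suffix (p ++ c ∷ u) eq₁))
      , clearable⇒clears gu (p ∷ʳ c) (c ∷ v ++ y) (trans eq (sym (++-assoc p _ _)))
      , length-++-≤ʳ y {v}
      , inj₁ (clearable⇒clears gv ((p ++ c ∷ u) ∷ʳ c) y (trans eq₁ (sym (++-assoc (p ++ c ∷ u) _ _)))))
    where eq₁ = trans eq (sym (++-assoc p (c ∷ u) _))
  clearable⇒clears (merge {c} {u} {v} gu gv) p y eq
    rewrite ++-assoc u (c ∷ v) y = via
      ( trans (letter-suffix p eq) (sym (letter-suffix (p ++ c ∷ u) eq₁))
      , clearable⇒clears gu (p ∷ʳ c) (c ∷ v ++ y) (trans eq (sym (++-assoc p _ _)))
      , length-++-≤ʳ y {v}
      , inj₂ (clearable⇒clears gv (p ++ c ∷ u) y eq₁))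
    where eq₁ = trans eq (sym (++-assoc p (c ∷ u) _))

-- The program

-- The outer loop passes from row r to row suc r of the table, the middle one
-- runs over q and the inner one over s ≤ q. ROW, NEW, LOW and HIGH are the base
-- addresses of the rows r, suc r, q and suc q; I and J are the positions of the
-- blocks at which the suffixes of lengths suc r and suc q start.
pattern LEN   = 1
pattern ONE   = 2
pattern WIDTH = 3
pattern I     = 4
pattern ROW   = 5
pattern NEW   = 6
pattern R     = 7
pattern J     = 8
pattern LOW   = 9
pattern Q     = 10
pattern HIGH  = 11
pattern S     = 12
pattern X     = 13
pattern Y     = 14
pattern Z     = 15
pattern ZERO  = 16

-- The comments number the jump targets.
program : Program
program =
    const ONE 1
  ∷ add WIDTH LEN ONE
  ∷ add I LEN ZERO
  ∷ add ROW WIDTH ZERO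
  ∷ store ROW ONE
  ∷ jzero I 45               -- 5
  ∷ sub I I ONE
  ∷ add NEW ROW WIDTH
  ∷ add R R ONE
  ∷ add X NEW R
  ∷ store X ONE
  ∷ add J LEN ZERO
  ∷ add LOW WIDTH ZERO
  ∷ const Q 0
  ∷ jzero J 43               -- 14
  ∷ sub J J ONE
  ∷ add HIGH LOW WIDTH
  ∷ add Q Q ONE
  ∷ load X I
  ∷ load Y J
  ∷ sub Z X Y
  ∷ sub Y Y X
  ∷ add Z Z Y
  ∷ jzero Z 25
  ∷ jump 41
  ∷ add X ROW Q              -- 25
  ∷ load X X
  ∷ jzero X 41
  ∷ add S Q ZERO
  ∷ jzero S 41               -- 29
  ∷ sub S S ONE
  ∷ add X LOW S
  ∷ load X X
  ∷ add Y HIGH S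
  ∷ load Y Y
  ∷ add X X Y
  ∷ add Y NEW S
  ∷ load Z Y
  ∷ add X X Z
  ∷ store Y X
  ∷ jump 29
  ∷ add LOW HIGH ZERO        -- 41
  ∷ jump 14
  ∷ add ROW NEW ZERO         -- 43
  ∷ jump 5
  ∷ load X ROW               -- 45
  ∷ jzero X 48
  ∷ halt true
  ∷ halt false               -- 48
  ∷ []

-- Memory updates, addresses and the comparison of colors

store-same : ∀ (μ : Store) {a b x} → b ≡ a → (μ [ a ≔ x ]) b ≡ x
store-same μ {a} {b} b≡a with b ≡ᵇ a | ≡⇒≡ᵇ b a b≡a
... | true | _ = refl

store-other : ∀ (μ : Store) {a b x} → b ≢ a → (μ [ a ≔ x ]) b ≡ μ b
store-other μ {a} {b} b≢a with b ≡ᵇ a | ≡ᵇ⇒≡ b a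
... | true  | eq = contradiction (eq _) b≢a
... | false | _  = refl

positive-+ : ∀ a {b} → 0 < a + b → 0 < a ⊎ 0 < b
positive-+ zero    0<b = inj₂ 0<b
positive-+ (suc a) _   = inj₁ (s≤s z≤n)

-- Uniqueness of division with remainder by `n`; with `n` the row width, it keeps distinct table
-- cells at distinct addresses.
digits-injective : ∀ n a b {s t} → s < n → t < n → a * n + s ≡ b * n + t → a ≡ b × s ≡ t
digits-injective n zero    zero    s<n t<n eq = refl , eq
digits-injective n zero    (suc b) s<n t<n eq =
  contradiction (≤-trans s<n (≤-trans (m≤m+n n (b * n)) (≤-trans (m≤m+n _ _) (≤-reflexive (sym eq))))) (<-irrefl refl)
digits-injective n (suc a) zero    s<n t<n eq =
  contradiction (≤-trans t<n (≤-trans (m≤m+n n (a * n)) (≤-trans (m≤m+n _ _) (≤-reflexive eq)))) (<-irrefl refl)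
digits-injective n (suc a) (suc b) {s} {t} s<n t<n eq
  with digits-injective n a b s<n t<n
         (+-cancelˡ-≡ n _ _ (trans (sym (+-assoc n (a * n) s)) (trans eq (+-assoc n (b * n) t))))
... | refl , s≡t = refl , s≡t

-- The machine can only test for zero, so colors are compared through the sum of both truncated
-- differences.
distance-zero : ∀ {a b} → a ∸ b + (b ∸ a) ≡ 0 → a ≡ b
distance-zero {a} {b} eq =
  ≤-antisym (m∸n≡0⇒m≤n (m+n≡0⇒m≡0 (a ∸ b) eq)) (m∸n≡0⇒m≤n (m+n≡0⇒n≡0 (a ∸ b) eq))

distance-self : ∀ {a b} → a ≡ b → a ∸ b + (b ∸ a) ≡ 0
distance-self {a} refl rewrite n∸n≡0 a = refl

-- Execution of the program and its invariants

module _ {k} (w : Puzzle k) where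

  open Positions (letter w)

  m width : ℕ
  m     = length w
  width = suc m

  -- The offset of one row keeps the table clear of the input.
  cell : ℕ → ℕ → ℕ
  cell r s = suc r * width + s

  -- The time is only bounded by `T`, so that branches of different lengths can be given a common
  -- bound by `weaken`.
  Halts : State → ℕ → Set
  Halts s T = ∃[ t ] ∃[ b ] (program ⊢ s ⇓[ t ] b) × Reflects (Solvable w) b × t ≤ T

  weaken : ∀ {s T T′} → T ≤ T′ → Halts s T → Halts s T′
  weaken T≤T′ (t , b , h , ans , t≤T) = t , b , h , ans , ≤-trans t≤T T≤T′

  run : ℕ → State → Maybe State
  run zero    s = just s
  run (suc n) s with fetch program (State.pc s)
  ... | nothing = nothing
  ... | just i with exec i s
  ...   | inj₁ s′ = run n s′
  ...   | inj₂ _  = nothing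

  -- Straight-line code is run by the type checker: with a literal program counter,
  -- `run n s ≡ just s′` holds by `refl` even for symbolic registers. A conditional jump blocks this
  -- evaluation and is left to the branch lemmas.
  steps : ∀ n {s s′ T} → run n s ≡ just s′ → Halts s′ T → Halts s (n + T)
  steps zero    refl h = h
  steps (suc n) {s} eq h with fetch program (State.pc s) in fetched
  ... | just i with exec i s in executed
  ...   | inj₁ s′ with steps n eq h
  ...     | t , b , h′ , ans , t≤T = suc t , b , step fetched executed h′ , ans , s≤s t≤T

  branch-zero : ∀ {pc ρ μ r l T} → fetch program pc ≡ just (jzero r l) → ρ r ≡ 0 →
                Halts ⟨ l , ρ , μ ⟩ T → Halts ⟨ pc , ρ , μ ⟩ (suc T)
  branch-zero {pc} {ρ} {l = l} fetched eq (t , b , h , ans , t≤T) =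
    suc t , b , step fetched (cong (λ x → inj₁ ⟨ (if x ≡ᵇ 0 then l else suc pc) , ρ , _ ⟩) eq) h , ans , s≤s t≤T

  branch-suc : ∀ {pc ρ μ r l T n} → fetch program pc ≡ just (jzero r l) → ρ r ≡ suc n →
               Halts ⟨ suc pc , ρ , μ ⟩ T → Halts ⟨ pc , ρ , μ ⟩ (suc T)
  branch-suc {pc} {ρ} {l = l} fetched eq (t , b , h , ans , t≤T) =
    suc t , b , step fetched (cong (λ x → inj₁ ⟨ (if x ≡ᵇ 0 then l else suc pc) , ρ , _ ⟩) eq) h , ans , s≤s t≤T

  branch : ∀ {pc ρ μ r l T} → fetch program pc ≡ just (jzero r l) →
           (ρ r ≡ 0 → Halts ⟨ l , ρ , μ ⟩ T) → (0 < ρ r → Halts ⟨ suc pc , ρ , μ ⟩ T) →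
           Halts ⟨ pc , ρ , μ ⟩ (suc T)
  branch {ρ = ρ} {r = r} fetched h₀ h₊ with ρ r in eq
  ... | zero  = branch-zero fetched eq (h₀ refl)
  ... | suc _ = branch-suc fetched eq (h₊ (s≤s z≤n))

  -- An entry is true when positive, not when equal to 1, because the program forms disjunctions by
  -- addition. As `r` is unbounded, `table` also covers the rows not yet filled.
  record Holds (μ : Store) (P : ℕ → ℕ → Set) : Set where
    constructor holds
    field
      input : ∀ {a} → a < m → μ a ≡ color w a
      table : ∀ {a} r s → s ≤ m → a ≡ cell r s → 0 < μ a ⇔ P r s
  open Holds

  holds-cong : ∀ {μ P P′} → (∀ r s → P r s ⇔ P′ r s) → Holds μ P → Holds μ P′
  holds-cong P⇔P′ (holds inp tab) = holds inp λ r s s≤m eq →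
    mk⇔ (to (P⇔P′ r s) ∘ to (tab r s s≤m eq)) (from (tab r s s≤m eq) ∘ from (P⇔P′ r s))

  write : ∀ {μ P P′ a x r s} → Holds μ P → a ≡ cell r s → s ≤ m → 0 < x ⇔ P′ r s →
          (∀ r′ s′ → ¬ (r′ ≡ r × s′ ≡ s) → P r′ s′ ⇔ P′ r′ s′) → Holds (μ [ a ≔ x ]) P′
  write {μ} {P} {P′} {a} {x} {r} {s} (holds inp tab) refl s≤m new old = holds
    -- Table addresses are at least `width`, hence beyond the input.
    (λ {b} b<m → trans (store-other μ λ { refl →
        contradiction (≤-trans b<m (≤-trans (m≤n⇒m≤1+n (m≤m+n m (r * width))) (m≤m+n _ s))) (<-irrefl refl) }) (inp b<m))
    table′
    where
    table′ : ∀ {b} r′ s′ → s′ ≤ m → b ≡ cell r′ s′ → 0 < (μ [ a ≔ x ]) b ⇔ P′ r′ s′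
    table′ r′ s′ s′≤m refl with cell r′ s′ ≟ℕ a
    ... | yes eq with digits-injective width (suc r′) (suc r) (s≤s s′≤m) (s≤s s≤m) eq
    ...   | refl , refl = subst (λ z → 0 < z ⇔ P′ r s) (sym (store-same μ eq)) new
    table′ r′ s′ s′≤m refl | no neq =
      subst (λ z → 0 < z ⇔ P′ r′ s′) (sym (store-other μ neq))
        (mk⇔ (to o ∘ to (tab r′ s′ s′≤m refl)) (from (tab r′ s′ s′≤m refl) ∘ from o))
      where o = old r′ s′ λ { (refl , refl) → neq refl }

  read-letter : ∀ {μ P a} r → Holds μ P → a + suc r ≡ m → μ a ≡ letter w r
  read-letter {a = a} r hld eq =
    trans (input hld (≤-trans (≤-trans (s≤s (m≤m+n a r)) (≤-reflexive (sym (+-suc a r)))) (≤-reflexive eq)))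
      (cong (color w) (trans (sym (m+n∸n≡m a (suc r))) (cong (_∸ suc r) eq)))

  Done : ℕ → ℕ → ℕ → Set
  Done r r′ s = r′ ≤ r × Clears r′ s

  -- No constructor reaches a row beyond `suc r`: those rows are still blank.
  data Partial (r : ℕ) (E : ℕ → Set) : ℕ → ℕ → Set where
    earlier : ∀ {r′ s} → r′ ≤ r → Clears r′ s → Partial r E r′ s
    current : ∀ {s} → E s → Partial r E (suc r) s

  partial-old : ∀ {r E r′ s} → r′ ≤ r → Partial r E r′ s ⇔ Clears r′ s
  partial-old r′≤r = mk⇔
    (λ { (earlier _ cl) → cl ; (current _) → contradiction r′≤r (<-irrefl refl) })
    (earlier r′≤r)

  partial-new : ∀ {r E s} → Partial r E (suc r) s ⇔ E s
  partial-new = mk⇔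
    (λ { (earlier r<r _) → contradiction r<r (<-irrefl refl) ; (current e) → e })
    current

  partial-cong : ∀ {r E E′} → (∀ s → E s ⇔ E′ s) → ∀ r′ s → Partial r E r′ s ⇔ Partial r E′ r′ s
  partial-cong E⇔E′ r′ s = mk⇔
    (λ { (earlier r′≤r cl) → earlier r′≤r cl ; (current e) → current (to (E⇔E′ s) e) })
    (λ { (earlier r′≤r cl) → earlier r′≤r cl ; (current e) → current (from (E⇔E′ s) e) })

  write-new : ∀ {μ r E E′ a x s} → Holds μ (Partial r E) → a ≡ cell (suc r) s → s ≤ m → 0 < x ⇔ E′ s →
              (∀ s′ → s′ ≢ s → E s′ ⇔ E′ s′) → Holds (μ [ a ≔ x ]) (Partial r E′)
  write-new {r = r} {E} {E′} {s = s} hld eq s≤m new old =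
    write hld eq s≤m (mk⇔ (from partial-new ∘ to new) (from new ∘ to partial-new)) rest
    where
    rest : ∀ r′ s′ → ¬ (r′ ≡ suc r × s′ ≡ s) → Partial r E r′ s′ ⇔ Partial r E′ r′ s′
    rest r′ s′ neq = mk⇔
      (λ { (earlier r′≤r cl) → earlier r′≤r cl ; (current e) → current (to (old s′ (neq ∘ (refl ,_))) e) })
      (λ { (earlier r′≤r cl) → earlier r′≤r cl ; (current e) → current (from (old s′ (neq ∘ (refl ,_))) e) })

  -- This is the content of row `suc r` once the partners below `q` have been tried; `s ≡ suc r` is
  -- the diagonal entry, which stems from `done`.
  Upto : ℕ → ℕ → ℕ → Set
  Upto r q s = s ≡ suc r ⊎ (∃[ q′ ] q′ < q × Via r q′ s)

  upto-suc : ∀ {r q s} → (Upto r q s ⊎ Via r q s) ⇔ Upto r (suc q) s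
  upto-suc {r} {q} {s} = mk⇔
    (λ { (inj₁ (inj₁ eq)) → inj₁ eq
       ; (inj₁ (inj₂ (q′ , q′<q , v))) → inj₂ (q′ , m<n⇒m<1+n q′<q , v)
       ; (inj₂ v) → inj₂ (q , ≤-refl , v) })
    back
    where
    back : Upto r (suc q) s → Upto r q s ⊎ Via r q s
    back (inj₁ eq) = inj₁ (inj₁ eq)
    back (inj₂ (q′ , q′<1+q , v)) with m≤n⇒m<n∨m≡n (≤-pred q′<1+q)
    ... | inj₁ q′<q = inj₁ (inj₂ (q′ , q′<q , v))
    ... | inj₂ refl = inj₂ v

  -- Trying the partners below `m` is exhaustive, since `Clears r (suc q)` forces `suc q ≤ r`.
  upto-all : ∀ {r} → suc r ≤ m → ∀ r′ s → Partial r (Upto r m) r′ s ⇔ Done (suc r) r′ s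
  upto-all {r} r<m r′ s = mk⇔
    (λ { (earlier r′≤r cl) → m≤n⇒m≤1+n r′≤r , cl
       ; (current (inj₁ refl)) → ≤-refl , done
       ; (current (inj₂ (_ , _ , v))) → ≤-refl , via v })
    back
    where
    back : Done (suc r) r′ s → Partial r (Upto r m) r′ s
    back (r′≤1+r , cl) with m≤n⇒m<n∨m≡n r′≤1+r
    ... | inj₁ r′<1+r = earlier (≤-pred r′<1+r) cl
    back (_ , done) | inj₂ refl = current (inj₁ refl)
    back (_ , via {q = q} v@(_ , cl , _)) | inj₂ refl =
      current (inj₂ (q , ≤-trans (clears⇒≥ cl) (<⇒≤ r<m) , v))

  -- The three nested loops

  -- s runs downwards, so the cells from n on have been updated with q.
  Scan : ℕ → ℕ → ℕ → ℕ → Set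
  Scan r q n s = Upto r q s ⊎ (n ≤ s × Via r q s)

  Registers : List (ℕ × ℕ) → Store → Set
  Registers vs ρ = All (λ (a , x) → ρ a ≡ x) vs

  base : ℕ → ℕ
  base r = suc r * width

  outer inner : ℕ → ℕ → List (ℕ × ℕ)
  outer i r = (LEN , m) ∷ (ONE , 1) ∷ (WIDTH , width) ∷ (ZERO , 0) ∷ (I , i) ∷ (ROW , base r) ∷ (R , r) ∷ []
  inner i r = (LEN , m) ∷ (ONE , 1) ∷ (WIDTH , width) ∷ (ZERO , 0) ∷ (I , i) ∷ (ROW , base r) ∷ (R , suc r) ∷
              (NEW , base (suc r)) ∷ []

  -- The loop lemmas take the correctness of the rest of the run as a continuation.
  scan : ∀ {i r j q T} n {ρ μ} → n ≤ suc q → suc q ≤ r → suc r ≤ m →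
         letter w r ≡ letter w q → Clears r (suc q) →
         Registers ((S , n) ∷ (J , j) ∷ (LOW , base q) ∷ (Q , suc q) ∷ (HIGH , base (suc q)) ∷ inner i r) ρ →
         Holds μ (Partial r (Scan r q n)) →
         (∀ {ρ μ} → Registers ((J , j) ∷ (Q , suc q) ∷ (HIGH , base (suc q)) ∷ inner i r) ρ →
            Holds μ (Partial r (Scan r q 0)) → Halts ⟨ 41 , ρ , μ ⟩ T) →
         Halts ⟨ 29 , ρ , μ ⟩ (suc (n * 12 + T))
  scan zero _ _ _ _ _ (eS ∷ eJ ∷ _ ∷ regs) hld next = branch-zero refl eS (next (eJ ∷ regs) hld)
  scan {r = r} {q = q} (suc n) {ρ} {μ} n<1+q q<r r<m same cl
       (eS ∷ eJ ∷ eLow ∷ eQ ∷ eHigh ∷ eLen ∷ eOne ∷ eW ∷ e0 ∷ eI ∷ eRow ∷ eR ∷ eNew ∷ []) hld next =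
    -- The loop test and these 11 instructions make up the 12 charged per round.
    branch-suc refl eS (steps 11 refl (scan n (<⇒≤ n<1+q) q<r r<m same cl
      (eS′ ∷ eJ ∷ eLow ∷ eQ ∷ eHigh ∷ eLen ∷ eOne ∷ eW ∷ e0 ∷ eI ∷ eRow ∷ eR ∷ eNew ∷ [])
      (write-new hld (cong₂ _+_ eNew eS′) n≤m new old) next))
    where
    eS′ : ρ S ∸ ρ ONE ≡ n
    eS′ = cong₂ _∸_ eS eOne

    n≤q : n ≤ q
    n≤q = ≤-pred n<1+q

    q≤r : q ≤ r
    q≤r = <⇒≤ q<r

    n≤m : n ≤ m
    n≤m = ≤-trans n≤q (≤-trans q≤r (<⇒≤ r<m))

    low : 0 < μ (ρ LOW + (ρ S ∸ ρ ONE)) ⇔ Partial r (Scan r q (suc n)) q n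
    low = table hld q n n≤m (cong₂ _+_ eLow eS′)

    high : 0 < μ (ρ HIGH + (ρ S ∸ ρ ONE)) ⇔ Partial r (Scan r q (suc n)) (suc q) n
    high = table hld (suc q) n n≤m (cong₂ _+_ eHigh eS′)

    here : 0 < μ (ρ NEW + (ρ S ∸ ρ ONE)) ⇔ Partial r (Scan r q (suc n)) (suc r) n
    here = table hld (suc r) n n≤m (cong₂ _+_ eNew eS′)

    a b c : ℕ
    a = μ (ρ LOW + (ρ S ∸ ρ ONE))
    b = μ (ρ HIGH + (ρ S ∸ ρ ONE))
    c = μ (ρ NEW + (ρ S ∸ ρ ONE))

    -- The old entry `c` records the partners below `q`. The entries `a` and `b` lie in rows `q` and
    -- `suc q`, finished because `suc q ≤ r`, and supply the two alternatives of `Via`.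
    sound : 0 < a + b + c → Scan r q n n
    sound pos with positive-+ (a + b) pos
    ... | inj₂ p with to partial-new (to here p)
    ...   | inj₁ u         = inj₁ u
    ...   | inj₂ (n<n , _) = contradiction n<n (<-irrefl refl)
    sound pos | inj₁ p with positive-+ a p
    ...   | inj₁ p′ = inj₂ (≤-refl , same , cl , n≤q , inj₁ (to (partial-old q≤r) (to low p′)))
    ...   | inj₂ p′ = inj₂ (≤-refl , same , cl , n≤q , inj₂ (to (partial-old q<r) (to high p′)))

    complete : Scan r q n n → 0 < a + b + c
    complete (inj₁ u) = ≤-trans (from here (current (inj₁ u))) (m≤n+m c (a + b))
    complete (inj₂ (_ , _ , _ , _ , inj₁ cl′)) =
      ≤-trans (from low (earlier q≤r cl′)) (≤-trans (m≤m+n a b) (m≤m+n (a + b) c))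
    complete (inj₂ (_ , _ , _ , _ , inj₂ cl′)) =
      ≤-trans (from high (earlier q<r cl′)) (≤-trans (m≤n+m b a) (m≤m+n (a + b) c))

    new : 0 < a + b + c ⇔ Scan r q n n
    new = mk⇔ sound complete

    old : ∀ s → s ≢ n → Scan r q (suc n) s ⇔ Scan r q n s
    old s s≢n = mk⇔ (map₂ λ (n<s , v) → <⇒≤ n<s , v)
                    (map₂ λ (n≤s , v) → ≤∧≢⇒< n≤s (s≢n ∘ sym) , v)

  -- Starting the scan at `suc q` omits nothing, as `Via` demands `s ≤ q`.
  scan-start : ∀ {r q} s → Upto r q s ⇔ Scan r q (suc q) s
  scan-start s = mk⇔ inj₁ λ
    { (inj₁ u) → u ; (inj₂ (q<s , _ , _ , s≤q , _)) → contradiction (≤-trans q<s s≤q) (<-irrefl refl) }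

  scan-end : ∀ {r q} s → Scan r q 0 s ⇔ Upto r (suc q) s
  scan-end s = mk⇔ (to upto-suc ∘ map₂ proj₂) (map₂ (z≤n ,_) ∘ from upto-suc)

  upto-skip : ∀ {r q} → (∀ s → ¬ Via r q s) → ∀ s → Upto r q s ⇔ Upto r (suc q) s
  upto-skip ¬v s = mk⇔ (to upto-suc ∘ inj₁) ([ id , (λ v → contradiction v (¬v s)) ] ∘ from upto-suc)

  -- The constants 17 and 12 count the instructions of the longest path through one round of the
  -- middle and outer loop, apart from the rounds of the nested loop but including the test that
  -- leaves it.
  partnerTime rowTime : ℕ
  partnerTime = 17 + m * 12
  rowTime     = 12 + m * partnerTime

  -- Equality of colors and `Clears r (suc q)` do not involve `s`, so both are tested once, ahead of
  -- the inner loop; the second is read off the finished row `r`. If either fails, partner `q`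
  -- contributes nothing and the row stays as it is.
  partners : ∀ {i r T} j q {ρ μ} → j + q ≡ m → i + suc r ≡ m →
          Registers ((J , j) ∷ (LOW , base q) ∷ (Q , q) ∷ inner i r) ρ →
          Holds μ (Partial r (Upto r q)) →
          (∀ {ρ μ} → Registers (inner i r) ρ → Holds μ (Partial r (Upto r m)) → Halts ⟨ 43 , ρ , μ ⟩ T) →
          Halts ⟨ 14 , ρ , μ ⟩ (suc (j * partnerTime + T))
  partners zero q refl ir (eJ ∷ eLow ∷ eQ ∷ regs) hld next = branch-zero refl eJ (next regs hld)
  partners {i} {r} {T} (suc j) q {ρ} {μ} jq ir
        (eJ ∷ eLow ∷ eQ ∷ eLen ∷ eOne ∷ eW ∷ e0 ∷ eI ∷ eRow ∷ eR ∷ eNew ∷ []) hld next =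
    weaken (+-monoʳ-≤ 18 (≤-reflexive (sym (+-assoc (m * 12) (j * partnerTime) T))))
      (branch-suc refl eJ (steps 8 refl (branch refl
        (λ d≡0 → steps 2 refl (branch refl
          (λ g≡0 → weaken (+-mono-≤ {3} {5} (s≤s (s≤s (s≤s z≤n))) (m≤n+m K (m * 12)))
            (continue (eJ′ ∷ eQ′ ∷ eHigh ∷ eLen ∷ eOne ∷ eW ∷ e0 ∷ eI ∷ eRow ∷ eR ∷ eNew ∷ [])
              (skip λ { s (_ , cl , _) → <-irrefl (sym g≡0) (from gate cl) })))
          (λ g>0 → weaken scan-time (steps 1 refl
            (scan (suc q) ≤-refl (clears⇒≥ (to gate g>0)) r<m
              (trans (sym colorI) (trans (distance-zero d≡0) colorJ)) (to gate g>0)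
              (trans (cong₂ _+_ eQ′ e0) (+-identityʳ _)
                ∷ eJ′ ∷ eLow ∷ eQ′ ∷ eHigh ∷ eLen ∷ eOne ∷ eW ∷ e0 ∷ eI ∷ eRow ∷ eR ∷ eNew ∷ [])
              (holds-cong (partial-cong scan-start) hld)
              (λ regs → continue regs ∘ holds-cong (partial-cong scan-end)))))))
        (λ d>0 → weaken (+-mono-≤ {4} {8} (s≤s (s≤s (s≤s (s≤s z≤n)))) (m≤n+m K (m * 12)))
          (steps 1 refl
            (continue (eJ′ ∷ eQ′ ∷ eHigh ∷ eLen ∷ eOne ∷ eW ∷ e0 ∷ eI ∷ eRow ∷ eR ∷ eNew ∷ [])
              (skip λ { s (same , _) →
                <-irrefl (sym (distance-self (trans colorI (trans same (sym colorJ))))) d>0 })))))))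
    where
    K : ℕ
    K = j * partnerTime + T

    jq′ : j + suc q ≡ m
    jq′ = trans (+-suc j q) jq

    q<m : suc q ≤ m
    q<m = ≤-trans (m≤n+m (suc q) j) (≤-reflexive jq′)

    r<m : suc r ≤ m
    r<m = ≤-trans (m≤n+m (suc r) i) (≤-reflexive ir)

    eJ′ : ρ J ∸ ρ ONE ≡ j
    eJ′ = cong₂ _∸_ eJ eOne

    eQ′ : ρ Q + ρ ONE ≡ suc q
    eQ′ = trans (cong₂ _+_ eQ eOne) (+-comm q 1)

    eHigh : ρ LOW + ρ WIDTH ≡ base (suc q)
    eHigh = trans (cong₂ _+_ eLow eW) (+-comm (base q) width)

    colorI : μ (ρ I) ≡ letter w r
    colorI = read-letter r hld (trans (cong (_+ suc r) eI) ir)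

    colorJ : μ (ρ J ∸ ρ ONE) ≡ letter w q
    colorJ = read-letter q hld (trans (cong (_+ suc q) eJ′) jq′)

    entry : 0 < μ (ρ ROW + (ρ Q + ρ ONE)) ⇔ Partial r (Upto r q) r (suc q)
    entry = table hld r (suc q) q<m (cong₂ _+_ eRow eQ′)

    gate : 0 < μ (ρ ROW + (ρ Q + ρ ONE)) ⇔ Clears r (suc q)
    gate = mk⇔ (to (partial-old ≤-refl) ∘ to entry) (from entry ∘ earlier ≤-refl)

    skip : (∀ s → ¬ Via r q s) → Holds μ (Partial r (Upto r (suc q)))
    skip ¬v = holds-cong (partial-cong (upto-skip ¬v)) hld

    scan-time : 2 + (suc q * 12 + (3 + K)) ≤ 5 + (m * 12 + K)
    scan-time = +-monoʳ-≤ 2 (≤-trans (≤-reflexive (x∙yz≈y∙xz (suc q * 12) 3 K))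
      (+-monoʳ-≤ 3 (+-monoˡ-≤ K (*-monoˡ-≤ 12 q<m))))

    continue : ∀ {ρ μ} → Registers ((J , j) ∷ (Q , suc q) ∷ (HIGH , base (suc q)) ∷ inner i r) ρ →
               Holds μ (Partial r (Upto r (suc q))) → Halts ⟨ 41 , ρ , μ ⟩ (3 + K)
    continue (eJ ∷ eQ ∷ eHigh ∷ eLen ∷ eOne ∷ eW ∷ e0 ∷ eI ∷ eRow ∷ eR ∷ eNew ∷ []) hld = steps 2 refl
      (partners j (suc q) jq′ ir
        (eJ ∷ trans (cong₂ _+_ eHigh e0) (+-identityʳ _) ∷ eQ
          ∷ eLen ∷ eOne ∷ eW ∷ e0 ∷ eI ∷ eRow ∷ eR ∷ eNew ∷ []) hld next)

  solvable⇔clears : Solvable w ⇔ Clears m 0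
  solvable⇔clears = mk⇔ forth back
    where
    forth : Solvable w → Clears m 0
    forth sol = subst (λ x → Clears (length x) 0) (++-identityʳ w)
      (clearable⇒clears w (solvable⇒clearable sol) [] [] (sym (++-identityʳ w)))

    back : Clears m 0 → Solvable w
    back cl with clears⇒clearable w cl [] w refl refl
    ... | u , [] , eq , _ , g =
      clearable⇒solvable (subst Clearable (sym (trans eq (++-identityʳ u))) g)

  rows : ∀ i r {ρ μ} → i + r ≡ m → Registers (outer i r) ρ → Holds μ (Done r) →
         Halts ⟨ 5 , ρ , μ ⟩ (4 + i * rowTime)
  rows zero r {ρ} {μ} refl (eLen ∷ eOne ∷ eW ∷ e0 ∷ eI ∷ eRow ∷ eR ∷ []) hld =
    branch-zero refl eI (steps 1 refl (branch refl
      (λ z → 1 , false , stop refl refl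
               , ofⁿ (λ sol → <-irrefl (sym z) (from answer (≤-refl , to solvable⇔clears sol))) , ≤-refl)
      (λ p → 1 , true , stop refl refl , ofʸ (from solvable⇔clears (proj₂ (to answer p))) , ≤-refl)))
    where
    -- `ROW` now addresses the first cell of row `m`, the entry for the whole word.
    answer : 0 < μ (ρ ROW) ⇔ Done m m 0
    answer = table hld m 0 z≤n (trans eRow (sym (+-identityʳ _)))
  rows (suc i) r {ρ} {μ} ir (eLen ∷ eOne ∷ eW ∷ e0 ∷ eI ∷ eRow ∷ eR ∷ []) hld =
    weaken (≤-reflexive time)
    (branch-suc refl eI (steps 8 refl
      (partners m 0 (+-identityʳ m) ir′
        ( trans (cong₂ _+_ eLen e0) (+-identityʳ m)
        ∷ cong₂ _+_ eW e0
        ∷ refl ∷ eLen ∷ eOne ∷ eW ∷ e0 ∷ cong₂ _∸_ eI eOne ∷ eRow ∷ eR′ ∷ eNew ∷ [])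
        -- No partner lies below 0, so the diagonal entry alone turns the blank row into `Upto r 0`.
        (write-new (holds-cong fresh hld) (cong₂ _+_ eNew eR′) r<m
          (mk⇔ (λ _ → inj₁ refl) (λ _ → ≤-reflexive (sym eOne)))
          (λ s s≢1+r → mk⇔ (λ ()) λ { (inj₁ s≡1+r) → s≢1+r s≡1+r }))
        λ { (eLen ∷ eOne ∷ eW ∷ e0 ∷ eI ∷ eRow ∷ eR ∷ eNew ∷ []) hld → steps 2 refl
          (rows i (suc r) ir′
            (eLen ∷ eOne ∷ eW ∷ e0 ∷ eI ∷ trans (cong₂ _+_ eNew e0) (+-identityʳ _) ∷ eR ∷ [])
            (holds-cong (upto-all r<m) hld)) })))
    where
    ir′ : i + suc r ≡ m
    ir′ = trans (+-suc i r) ir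

    r<m : suc r ≤ m
    r<m = ≤-trans (m≤n+m (suc r) i) (≤-reflexive ir′)

    eNew : ρ ROW + ρ WIDTH ≡ base (suc r)
    eNew = trans (cong₂ _+_ eRow eW) (+-comm (base r) width)

    eR′ : ρ R + ρ ONE ≡ suc r
    eR′ = trans (cong₂ _+_ eR eOne) (+-comm r 1)

    fresh : ∀ r′ s → Done r r′ s ⇔ Partial r (λ _ → ⊥) r′ s
    fresh r′ s = mk⇔ (λ (r′≤r , cl) → earlier r′≤r cl) λ { (earlier r′≤r cl) → r′≤r , cl }

    time : 10 + (m * partnerTime + (6 + i * rowTime)) ≡ 4 + suc i * rowTime
    time = cong (10 +_) (x∙yz≈y∙xz (m * partnerTime) 6 (i * rowTime))

  decides : Halts (initial w) (9 + m * rowTime)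
  decides = steps 5 refl (rows m 0 (+-identityʳ m)
    (refl ∷ refl ∷ +-comm m 1 ∷ refl ∷ +-identityʳ m
      ∷ eRow ∷ refl ∷ [])
    -- Row 0 consists of the single entry `done` in column 0.
    (write {P = λ _ _ → ⊥} {r = 0} {s = 0} blank (trans eRow (sym (+-identityʳ _))) z≤n
      (mk⇔ (λ _ → z≤n , done) (λ _ → s≤s z≤n))
      λ { r s neq → mk⇔ (λ ()) λ { (z≤n , done) → neq (refl , refl) } }))
    where
    eRow : m + 1 + 0 ≡ base 0
    eRow = trans (+-identityʳ (m + 1)) (trans (+-comm m 1) (sym (+-identityʳ width)))

    -- Memory beyond the input is initially 0, so every table entry starts out false.
    blank : Holds (color w) (λ _ _ → ⊥)
    blank = holds (λ _ → refl) λ { r s _ refl → mk⇔ (λ pos → <-irrefl (sym (outside r s)) pos) (λ ()) }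
      where
      outside : ∀ r s → color w (cell r s) ≡ 0
      outside r s rewrite drop-all (cell r s) w
        (≤-trans (m≤n⇒m≤1+n (m≤m+n m (r * width))) (m≤m+n (width + r * width) s)) = refl

-- The cubic time bound in the number of groups

-- The constant 50 is the coefficient sum 9 + 12 + 17 + 12. The polynomial added below is the exact
-- difference of the two sides for `m` equal to `suc p`.
program-time : ∀ m → 1 ≤ m → 9 + m * (12 + m * (17 + m * 12)) ≤ 50 * m ^ 3
program-time (suc p) _ = ≤-trans (m≤m+n _ (38 * (p * p * p) + 97 * (p * p) + 68 * p)) (≤-reflexive (expand p))
  where
  expand : ∀ p → 9 + suc p * (12 + suc p * (17 + suc p * 12)) + (38 * (p * p * p) + 97 * (p * p) + 68 * p)
             ≡ 50 * (suc p * (suc p * (suc p * 1)))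
  expand = solve-∀

cube-double : ∀ g → 50 * (2 * g * (2 * g * (2 * g * 1))) ≡ 400 * (g * (g * (g * 1)))
cube-double = solve-∀

corollary6 : ∃[ P ] ∃[ C ] ∀ (k : ℕ) (w : Puzzle k) →
    ∃[ t ] ∃[ b ]
    (P ⊢ initial w ⇓[ t ] b)
    × Reflects (Solvable w) b
    × (Reduced w → 1 ≤ #groups w → t ≤ C * (k * #groups w ^ 3))
-- A reduced word has at most twice as many blocks as groups, which turns 50 into 50 times 8.
corollary6 = program , 400 , decide
  where
  decide : ∀ k (w : Puzzle k) → ∃[ t ] ∃[ b ]
    (program ⊢ initial w ⇓[ t ] b)
    × Reflects (Solvable w) b
    × (Reduced w → 1 ≤ #groups w → t ≤ 400 * (k * #groups w ^ 3))
  decide k w with decides w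
  ... | t , b , run , answer , t≤ = t , b , run , answer , bound w t≤
    where
    bound : ∀ {k} (w : Puzzle k) {t} → t ≤ 9 + length w * (12 + length w * (17 + length w * 12)) →
            Reduced w → 1 ≤ #groups w → t ≤ 400 * (k * #groups w ^ 3)
    bound []              t≤ red ()
    -- A block has a color, so the number of colors is positive and multiplying by it can only
    -- increase the bound.
    bound {suc k} w@(_ ∷ _) {t} t≤ red _ = begin
      t                                                           ≤⟨ t≤ ⟩
      9 + length w * (12 + length w * (17 + length w * 12))       ≤⟨ program-time (length w) (s≤s z≤n) ⟩
      50 * length w ^ 3                                           ≤⟨ *-monoʳ-≤ 50 (^-monoˡ-≤ 3 (length≤2*#groups w red)) ⟩
      50 * (2 * #groups w) ^ 3                                    ≡⟨ cube-double (#groups w) ⟩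
      400 * #groups w ^ 3                                         ≤⟨ *-monoʳ-≤ 400 (m≤n*m (#groups w ^ 3) (suc k)) ⟩
      400 * (suc k * #groups w ^ 3)                               ∎
      where open ≤-Reasoning
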